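{- With the terms $M'$ and $N$ of the symmetric $\lambda\mu$-calculus given by $M'=\langle (\beta\;\lambda x(x\;M_1)),(\beta\;\lambda x(x\;M_0))\rangle$ and $N=(\alpha\;\lambda z(\alpha\;z))$, where $\alpha,\beta$ are $\mu$-variables and $M_0$, $M_1$ and the pairing $\langle\cdot,\cdot\rangle$ are the explicit terms defined in the context, one has $M'[\beta=_r\mu\alpha N]\in SN$ but $(\mu\beta M'\;\mu\alpha N)\notin SN$.
   Context: Terms of the (untyped) symmetric $\lambda\mu$-calculus are given by the grammar $\mathcal T ::= x \mid \lambda x\,\mathcal T \mid (\mathcal T\;\mathcal T) \mid \mu\alpha\,\mathcal T \mid (\alpha\;\mathcal T)$, where $x,y,\dots$ range over $\lambda$-variables and $\alpha,\beta,\dots$ over $\mu$-variables ($\lambda x$ binds $x$, $\mu\alpha$ binds $\alpha$; terms are taken up to renaming of bound variables, and substitutions are capture-avoiding). Application associates to the left: $(M\;N_1\dots N_n)$ means $((M\;N_1)\dots N_n)$. One-step reduction $\triangleright$ is the closure under all term contexts of the three rules ($\beta$) $(\lambda x M\;N)\triangleright M[x:=N]$; ($\mu$) $(\mu\alpha M\;N)\triangleright \mu\alpha\, M[\alpha=_r N]$; ($\mu'$) $(M\;\mu\alpha N)\triangleright \mu\alpha\, N[\alpha=_l M]$. Here $M[\alpha=_r N]$ is obtained from $M$ by (recursively) replacing each sub-term of $M$ of the form $(\alpha\;U)$ ($\alpha$ free) by $(\alpha\;(U\;N))$, and $N[\alpha=_l M]$ is obtained from $N$ by (recursively) replacing each sub-term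 of $N$ of the form $(\alpha\;U)$ by $(\alpha\;(M\;U))$. $SN$ is the set of terms having no infinite $\triangleright$-reduction sequence. Explicit terms: $\underline 0=\lambda x\lambda y\, y$, $\underline 1=\lambda x\lambda y\, x$, $\Delta=\lambda x (x\;x)$, $P=\lambda x\lambda y\lambda z\,\big(y\;(z\;\underline 1\;\underline 0)\;(z\;\underline 0\;\underline 1)\;(\lambda d\,\underline 1)\;\Delta\;\Delta\big)$, $M_0=\lambda x(x\;P\;\underline 0)$, $M_1=\lambda x(x\;P\;\underline 1)$. For terms $T_1,T_0$, $\langle T_1,T_0\rangle$ denotes the term $\lambda f(f\;T_1\;T_0)$ where $f$ is a fresh $\lambda$-variable. -}

module Defs where

open import Data.Bool.Base using (if_then_else_)
open import Data.Fin.Base using (Fin; zero; suc; lift)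
open import Data.Fin.Properties using (_≟_)
open import Data.Nat.Base using (ℕ; zero; suc)
open import Data.Product.Base using (∃-syntax)
open import Function.Base using (flip; id)
open import Induction.InfiniteDescent using (InfiniteDescendingSequenceFrom)
open import Relation.Nullary using (¬_; does)

-- Well-scoped de Bruijn terms: n counts the free λ-variables and m the free
-- μ-variables in scope, so syntactic identity is α-equivalence.

infixl 7 _·_
infixr 6 ƛ_ μ_

data Term (n m : ℕ) : Set where
  var  : Fin n → Term n m
  ƛ_   : Term (suc n) m → Term n m
  _·_  : Term n m → Term n m → Term n m
  μ_   : Term n (suc m) → Term n m
  name : Fin m → Term n m → Term n m   -- (α T)

rename : ∀ {n n′ m m′} → (Fin n → Fin n′) → (Fin m → Fin m′) →
         Term n m → Term n′ m′
rename ρ τ (var x)    = var (ρ x)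
rename ρ τ (ƛ M)      = ƛ rename (lift 1 ρ) τ M
rename ρ τ (M · N)    = rename ρ τ M · rename ρ τ N
rename ρ τ (μ M)      = μ rename ρ (lift 1 τ) M
rename ρ τ (name α M) = name (τ α) (rename ρ τ M)

weakenλ : ∀ {n m} → Term n m → Term (suc n) m
weakenλ = rename suc id

weakenμ : ∀ {n m} → Term n m → Term n (suc m)
weakenμ = rename id suc

liftλ : ∀ {n n′ m} → (Fin n → Term n′ m) → Fin (suc n) → Term (suc n′) m
liftλ σ zero    = var zero
liftλ σ (suc x) = weakenλ (σ x)

subst : ∀ {n n′ m} → (Fin n → Term n′ m) → Term n m → Term n′ m
subst σ (var x)    = σ x
subst σ (ƛ M)      = ƛ subst (liftλ σ) M
subst σ (M · N)    = subst σ M · subst σ N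
subst σ (μ M)      = μ subst (λ x → weakenμ (σ x)) M
subst σ (name α M) = name α (subst σ M)

single : ∀ {n m} → Term n m → Fin (suc n) → Term n m
single N zero    = N
single N (suc x) = var x

infixl 8 _[_] _[_=r_] _[_=l_]

_[_] : ∀ {n m} → Term (suc n) m → Term n m → Term n m
M [ N ] = subst (single N) M

-- M [ α =r N ] turns every (α U) into (α (U N)), recursively in U but not in
-- the inserted N. The μ-variable α stays free, so the scope is unchanged.

_[_=r_] : ∀ {n m} → Term n m → Fin m → Term n m → Term n m
var x    [ α =r N ] = var x
(ƛ M)    [ α =r N ] = ƛ (M [ α =r weakenλ N ])
(M · M′) [ α =r N ] = (M [ α =r N ]) · (M′ [ α =r N ])
(μ M)    [ α =r N ] = μ (M [ suc α =r weakenμ N ])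
name γ M [ α =r N ] =
  name γ (if does (γ ≟ α) then (M [ α =r N ]) · N else M [ α =r N ])

-- Dually, M [ α =l N ] turns every (α U) into (α (N U)).

_[_=l_] : ∀ {n m} → Term n m → Fin m → Term n m → Term n m
var x    [ α =l N ] = var x
(ƛ M)    [ α =l N ] = ƛ (M [ α =l weakenλ N ])
(M · M′) [ α =l N ] = (M [ α =l N ]) · (M′ [ α =l N ])
(μ M)    [ α =l N ] = μ (M [ suc α =l weakenμ N ])
name γ M [ α =l N ] =
  name γ (if does (γ ≟ α) then N · (M [ α =l N ]) else M [ α =l N ])

infix 4 _▷_

data _▷_ {n m : ℕ} : Term n m → Term n m → Set where
  β-red  : ∀ {M N} → (ƛ M) · N ▷ M [ N ]
  μ-red  : ∀ {M N} → (μ M) · N ▷ μ (M [ zero =r weakenμ N ])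
  μ′-red : ∀ {M N} → M · (μ N) ▷ μ (N [ zero =l weakenμ M ])
  ƛ-cong    : ∀ {M M′} → M ▷ M′ → ƛ M ▷ ƛ M′
  ·-congˡ   : ∀ {M M′ N} → M ▷ M′ → M · N ▷ M′ · N
  ·-congʳ   : ∀ {M N N′} → N ▷ N′ → M · N ▷ M · N′
  μ-cong    : ∀ {M M′} → M ▷ M′ → μ M ▷ μ M′
  name-cong : ∀ {α M M′} → M ▷ M′ → name α M ▷ name α M′

-- The library's sequences descend, hence the flip.

SN : ∀ {n m} → Term n m → Set
SN M = ¬ (∃[ f ] InfiniteDescendingSequenceFrom (flip _▷_) f M)

𝟎 𝟏 Δ P M₀ M₁ : ∀ {n m} → Term n m
𝟎  = ƛ ƛ var zero
𝟏  = ƛ ƛ var (suc zero)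
Δ  = ƛ var zero · var zero
P  = ƛ ƛ ƛ y · (z · 𝟏 · 𝟎) · (z · 𝟎 · 𝟏) · (ƛ 𝟏) · Δ · Δ
  where
  y z : ∀ {n m} → Term (suc (suc n)) m
  y = var (suc zero)
  z = var zero
M₀ = ƛ var zero · P · 𝟎
M₁ = ƛ var zero · P · 𝟏

⟨_,_⟩ : ∀ {n m} → Term n m → Term n m → Term n m
⟨ T₁ , T₀ ⟩ = ƛ var zero · weakenλ T₁ · weakenλ T₀

M′ : ∀ {n m} → Fin m → Term n m
M′ β = ⟨ name β (ƛ var zero · M₁) , name β (ƛ var zero · M₀) ⟩

N : ∀ {n m} → Fin m → Term n m
N α = name α (ƛ name α (var zero))

module Submission where

-- With A = μα N, the term M′[β =r A] is λf (f (β U₁) (β U₀)) for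
-- Uᵢ = (λx (x Mᵢ) A). Its two components reduce independently, and Uᵢ only
-- ever applies Mᵢ to itself, which is harmless: the reduction tree of Uᵢ is
-- finite and can be searched exhaustively. Firing (μβ M′ A) by μ′ instead
-- duplicates μβ M′ through the two occurrences of α in N; picking the first
-- component of one copy and the second of the other yields (M₁ M₀), which
-- reduces to (Δ Δ).

open import Defs
open import Data.Bool.Base using (Bool; false; T)
open import Data.Bool.ListAction using (all)
open import Data.Fin.Base using (zero)
open import Data.List.Base using (List; []; _∷_; _++_; map)
open import Data.List.Membership.Propositional using (_∈_)
open import Data.List.Membership.Propositional.Properties using (∈-++⁺ˡ; ∈-++⁺ʳ; ∈-map⁺)
open import Data.List.Relation.Unary.All using (lookup)
open import Data.List.Relation.Unary.All.Properties using (all⁺)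
open import Data.List.Relation.Unary.Any using (here)
open import Data.Nat.Base using (ℕ; zero; suc)
open import Data.Product.Base using (_×_; _,_; ∃-syntax)
open import Data.Unit.Base using (tt)
open import Function.Base using (flip; _∘_)
open import Induction.InfiniteDescent
  using (InfiniteDescendingSequenceFrom; descent∧acc⇒unsatisfiable)
open import Induction.WellFounded using (Acc; acc)
open import Relation.Binary.PropositionalEquality using (refl)
open import Relation.Nullary using (¬_)

private
  variable
    n m n′ m′ : ℕ
    M M⁺ : Term n m

Diverges : Term n m → Set
Diverges M = ∃[ f ] InfiniteDescendingSequenceFrom (flip _▷_) f M

infixr 3 _◂_

_◂_ : M ▷ M⁺ → Diverges M⁺ → Diverges M
_◂_ {M = M} r (f , refl , s) =
  (λ { zero → M ; (suc k) → f k }) , refl , λ { zero → r ; (suc k) → s k }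

diverges-cong : {C : Term n m → Term n′ m′} →
                (∀ {K L} → K ▷ L → C K ▷ C L) → Diverges M → Diverges (C M)
diverges-cong {C = C} C-cong (f , refl , s) = C ∘ f , refl , λ k → C-cong (s k)

-- Accessibility is the inductive form of termination: unlike the negative `SN`, it supports
-- recursion on proofs and can be certified by computation.
Strong : Term n m → Set
Strong = Acc (flip _▷_)

Strong⇒SN : Strong M → SN M
Strong⇒SN = descent∧acc⇒unsatisfiable {P = Diverges}
  λ { (f , refl , s) → f 1 , s 0 , f ∘ suc , refl , s ∘ suc }

-- The head is a variable and both arguments are named terms, not μ-abstractions, so every redex
-- lies inside `U` or `V`, and each step decreases one of the two accessibility proofs.
Strong-pair : ∀ {x α β} {U V : Term (suc n) m} → Strong U → Strong V →
              Strong (ƛ var x · name α U · name β V)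
Strong-pair {U = U} {V} u@(acc us) v@(acc vs) = acc λ where
  (ƛ-cong (·-congˡ (·-congˡ ())))
  (ƛ-cong (·-congˡ (·-congʳ (name-cong r)))) → Strong-pair (us r) v
  (ƛ-cong (·-congʳ (name-cong r)))           → Strong-pair u (vs r)

-- Split by the side that triggers the contraction: `(μ M) · (μ N)` has a contractum of each kind.
functionContracta argumentContracta : Term n m → Term n m → List (Term n m)
functionContracta (ƛ M) N = M [ N ] ∷ []
functionContracta (μ M) N = μ (M [ zero =r weakenμ N ]) ∷ []
functionContracta _     _ = []
argumentContracta M (μ N) = μ (N [ zero =l weakenμ M ]) ∷ []
argumentContracta _ _     = []

reducts : Term n m → List (Term n m)
reducts (var x)    = []
reducts (ƛ M)      = map ƛ_ (reducts M)
reducts (M · N)    = functionContracta M N ++ argumentContracta M N ++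
                     map (_· N) (reducts M) ++ map (M ·_) (reducts N)
reducts (μ M)      = map μ_ (reducts M)
reducts (name α M) = map (name α) (reducts M)

reducts-complete : M ▷ M⁺ → M⁺ ∈ reducts M
reducts-complete β-red         = here refl
reducts-complete μ-red         = here refl
reducts-complete (μ′-red {M})  = ∈-++⁺ʳ (functionContracta M _) (here refl)
reducts-complete (ƛ-cong r)    = ∈-map⁺ ƛ_ (reducts-complete r)
reducts-complete (·-congˡ {M} {N = N} r) =
  ∈-++⁺ʳ (functionContracta M N) (∈-++⁺ʳ (argumentContracta M N)
    (∈-++⁺ˡ (∈-map⁺ (_· N) (reducts-complete r))))
reducts-complete (·-congʳ {M} {N} r) =
  ∈-++⁺ʳ (functionContracta M N) (∈-++⁺ʳ (argumentContracta M N)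
    (∈-++⁺ʳ (map (_· N) (reducts M)) (∈-map⁺ (M ·_) (reducts-complete r))))
reducts-complete (μ-cong r)    = ∈-map⁺ μ_ (reducts-complete r)
reducts-complete (name-cong r) = ∈-map⁺ (name _) (reducts-complete r)

-- Exhausted fuel counts as failure, so a positive answer certifies that the whole reduction tree
-- was explored.
heightBelow : ℕ → Term n m → Bool
heightBelow zero    M = false
heightBelow (suc k) M = all (heightBelow k) (reducts M)

heightBelow-sound : ∀ k (M : Term n m) → T (heightBelow k M) → Strong M
heightBelow-sound (suc k) M h = acc λ r →
  heightBelow-sound k _ (lookup (all⁺ (heightBelow k) (reducts M) h) (reducts-complete r))

Δ·Δ-diverges : Diverges {n} {m} (Δ · Δ)
Δ·Δ-diverges = (λ _ → Δ · Δ) , refl , λ _ → β-red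

-- `P` compares two bits: `y` selects `z · 𝟏 · 𝟎` or `z · 𝟎 · 𝟏`, giving `𝟏` if `y` and `z` agree
-- and `𝟎` if they differ. Here `P · P · 𝟎 · 𝟏` is reached, and the resulting `𝟎` discards `ƛ 𝟏`,
-- leaving `Δ · Δ`.
M₁·M₀-diverges : Diverges {n} {m} (M₁ · M₀)
M₁·M₀-diverges =
  β-red ◂ ·-congˡ β-red ◂ ·-congˡ (·-congˡ β-red) ◂ ·-congˡ β-red ◂ β-red ◂
  spine (·-congˡ β-red) ◂ spine β-red ◂
  spine (·-congˡ β-red) ◂ spine β-red ◂
  ·-congˡ (·-congˡ β-red) ◂ ·-congˡ β-red ◂ Δ·Δ-diverges
  where
  spine : ∀ {A B C K L : Term n m} → K ▷ L → K · A · B · C ▷ L · A · B · C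
  spine r = ·-congˡ (·-congˡ (·-congˡ r))

proposition4p5 : (n m : ℕ) →
    SN {n} {suc m} (M′ zero [ zero =r μ N zero ]) ×
    ¬ SN {n} {m} ((μ M′ zero) · (μ N zero))
proposition4p5 n m =
  -- The fuel 40 is a sufficient bound, confirmed by evaluation; both components are closed, so the
  -- search computes with `n` and `m` abstract.
  Strong⇒SN (Strong-pair (heightBelow-sound 40 _ tt) (heightBelow-sound 40 _ tt)) ,
  λ sn → sn
    (μ′-red ◂ diverges-cong (μ-cong ∘ name-cong)
      -- The outer copy of `μ M′ zero` has as argument a λ-abstraction applying the inner copy; its
      -- first component feeds `M₁` to that copy.
      (μ-red ◂ diverges-cong (μ-cong ∘ ƛ-cong ∘ ·-congˡ ∘ ·-congʳ ∘ name-cong)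
        (β-red ◂ β-red ◂ diverges-cong name-cong
          -- The second component of the inner copy applies the received `M₁` to `M₀`.
          (μ-red ◂ diverges-cong (μ-cong ∘ ƛ-cong ∘ ·-congʳ ∘ name-cong)
            (β-red ◂ M₁·M₀-diverges)))))
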